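{- Let $n\ge 1$ and let $R=(r_1,\dots,r_n)$ and $S=(s_1,\dots,s_n)$ be vectors of nonnegative integers, all of whose components are at most $n$, with $\sum_i r_i=\sum_j s_j$. Then $\mathcal{A}^{4}(R,S)\neq\emptyset$ if and only if all of the following hold: (a) $R=S$; (b) $R$ is palindromic, i.e. $r_i=r_{n+1-i}$ for all $i$; (c) if $n$ is even then every component of $R$ is even, and if $n$ is odd then $o(R)=r_{\lceil n/2\rceil}$, where $o(R)$ is the number of odd components of $R$; (d) $\check{R}\preceq\check{R}^*$, where $\check{R}=(\lfloor r_1/2\rfloor,\lfloor r_2/2\rfloor,\dots,\lfloor r_{\lfloor n/2\rfloor}/2\rfloor)$.
   Context: The dihedral group $D_4$ of the square (of order $8$) acts on $n\times n$ matrices by rotations and reflections of the square array; it is generated by the transposition $A\mapsto A^t$ and the reflection $(r_\infty A)_{i,j}=a_{i,\,n+1-j}$. $\mathcal{A}^{4}(R,S)$ is the set of $n\times n$ matrices with entries in $\{0,1\}$, with $i$th row sum $r_i$ and $j$th column sum $s_j$ for all $i,j$, that are fixed by every element of $D_4$. For a nonnegative integer vector $R$, $R^*$ denotes the conjugate of (the weakly decreasing rearrangement of) $R$ viewed as an integer partition: its $k$th component is the number of $i$ with $r_i\ge k$. For nonnegative integer vectors $U,V$, $V\preceq U$ ($V$ is majorized by $U$) means that, after rearranging both in weakly decreasing order (and padding with zeros to a common length), $u_1+\dots+u_\ell\ge v_1+\dots+v_\ell$ for all $\ell$, and the total sums of $U$ and $V$ are equal. -}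

module Defs where

import Algebra.Properties.CommutativeMonoid.Sum
open import Data.Fin using (Fin; toℕ; fromℕ<; inject≤; opposite)
open import Data.List using (List; applyUpTo; filter; length; take)
open import Data.List.Extrema.Nat using (max)
import Data.Nat.ListAction as ℕ
open import Data.Nat using (ℕ; suc; _≤_; _≤?_; s≤s; ⌊_/2⌋; NonZero)
open import Data.Nat.Divisibility using (_∣_; _∣?_)
open import Data.Nat.Properties
  using (+-0-commutativeMonoid; ≤-decTotalOrder; ⌊n/2⌋≤n)
open import Data.Product using (_×_)
open import Data.Vec.Functional using (Vector; toList)
open import Function using (id; _∘_)
open import Relation.Binary.PropositionalEquality using (_≡_)
open import Relation.Nullary using (¬_; ¬?)
import Data.List.Sort as Sort
import Relation.Binary.Construct.Flip.EqAndOrd as Flip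

open Algebra.Properties.CommutativeMonoid.Sum +-0-commutativeMonoid public
  using (sum)

private
  variable
    n : ℕ

Matrix : ℕ → Set
Matrix n = Fin n → Fin n → Fin 2

-- Without function extensionality, equality of matrices is entrywise.
infix 4 _≈_

_≈_ : Matrix n → Matrix n → Set
A ≈ B = ∀ i j → A i j ≡ B i j

transpose : Matrix n → Matrix n
transpose A i j = A j i

-- `opposite` sends the 1-based index j to n + 1 - j.
reflect : Matrix n → Matrix n
reflect A i j = A i (opposite j)

-- `D₄ g` says that g is one of the transformations by which the dihedral
-- group acts.  Both generators are involutions, so the monoid they generate
-- is already closed under inverses.
data D₄ {n : ℕ} : (Matrix n → Matrix n) → Set where
  ι∈ : D₄ id
  τ∈ : D₄ transpose
  ρ∈ : D₄ reflect
  ∘∈ : ∀ {g h} → D₄ g → D₄ h → D₄ (g ∘ h)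

record 𝒜⁴ (R S : Vector ℕ n) (A : Matrix n) : Set where
  field
    rowSums : ∀ i → sum (λ j → toℕ (A i j)) ≡ R i
    colSums : ∀ j → sum (λ i → toℕ (A i j)) ≡ S j
    fixed   : ∀ {g} → D₄ g → g A ≈ A

Palindromic : Vector ℕ n → Set
Palindromic R = ∀ i → R i ≡ R (opposite i)

Even Odd : ℕ → Set
Even k = 2 ∣ k
Odd k  = ¬ Even k

oddCount : Vector ℕ n → ℕ
oddCount R = length (filter (λ r → ¬? (2 ∣? r)) (toList R))

-- The 1-based index ⌈ n /2⌉: for n = suc m its 0-based value is
-- ⌈ suc m /2⌉ - 1 = ⌊ m /2⌋.
middle : (n : ℕ) .{{_ : NonZero n}} → Fin n
middle (suc m) = fromℕ< (s≤s (⌊n/2⌋≤n m))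

halved : Vector ℕ n → Vector ℕ ⌊ n /2⌋
halved {n} R i = ⌊ R (inject≤ i (⌊n/2⌋≤n n)) /2⌋

-- Lists the components k = 1, …, max xs; all later ones are zero.
conjugate : List ℕ → List ℕ
conjugate xs = applyUpTo (λ k → length (filter (suc k ≤?_) xs)) (max 0 xs)

open Sort (Flip.decTotalOrder ≤-decTotalOrder) public
  using () renaming (sort to sortDescending)

-- Since `take ℓ` returns the whole list once ℓ exceeds its length, padding
-- with zeros is implicit.
infix 4 _⪯_

_⪯_ : List ℕ → List ℕ → Set
V ⪯ U = ℕ.sum U ≡ ℕ.sum V
      × (∀ ℓ → ℕ.sum (take ℓ (sortDescending V))
          ≤ ℕ.sum (take ℓ (sortDescending U)))

{-# OPTIONS --safe #-}

-- A matrix fixed by D₄ is determined by its upper left quarter, a symmetric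
-- 0/1 matrix with row sums ⌊ rᵢ /2⌋, together with (for odd n) its middle row
-- and column, whose entries are the parities of the rᵢ.  So the claim reduces to
-- the symmetric Gale–Ryser theorem: b is the row sum vector of a symmetric 0/1
-- matrix iff b ⪯ b*.  Necessity is double counting.  For sufficiency, a vertex
-- of maximal degree d is joined to itself and to d − 1 largest others, and
-- deleted; written as inequalities over all pairs (u , v) of sets of rows and
-- columns, the dominance condition is inherited by the remaining degrees.

module Submission where

open import Defs
open import Data.Nat
  using (ℕ; zero; suc; _+_; _*_; _∸_; _⊓_; _≤_; _<_; _≥_; z≤n; s≤s; _≤?_; _<?_; ⌊_/2⌋; NonZero)
open import Data.Nat.Properties
open import Algebra.Properties.Semiring.Sum +-*-semiring
  using (∑-comm; ∑-distrib-+; sum-cong-≗; sum-init-last; sum-permute; sum-replicate-zero;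
         *-distribˡ-sum; *-distribʳ-sum)
open import Data.Fin using (Fin; zero; suc; toℕ; fromℕ; inject₁; inject≤; opposite)
open import Data.Fin.Patterns using (0F; 1F)
open import Data.Fin.Permutation as Perm using (Permutation′; _⟨$⟩ʳ_; _⟨$⟩ˡ_)
open import Data.Fin.Properties
  using (any?; toℕ-injective; toℕ-fromℕ<; toℕ-inject₁; toℕ-inject≤; opposite-involutive)
  renaming (_≟_ to _≟ᶠ_)
open import Data.Fin.Relation.Unary.Top using (view; view-fromℕ; view-inject₁; ‵fromℕ; ‵inject₁)
open import Data.List using (List; _∷_; []; _++_; map; take; applyUpTo; filter; length)
open import Data.List.Extrema.Nat using (max; xs≤max)
open import Data.List.Properties
  using (map-tabulate; applyUpTo-∷ʳ; map-id-local; map-cong-local; filter-accept; filter-reject; take-[])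
open import Data.List.Relation.Binary.Equality.Propositional using (≋⇒≡)
open import Data.List.Relation.Binary.Permutation.Propositional as ↭ using (_↭_; ↭-sym; ↭⇒↭ₛ)
open import Data.List.Relation.Unary.All as All using ()
open import Data.List.Relation.Unary.Linked using (Linked; [-]; _∷_; tail)
open import Data.List.Relation.Unary.Linked.Properties using (applyUpTo⁺₂)
open import Data.List.Relation.Unary.Sorted.TotalOrder.Properties using (↗↭↗⇒≋)
open import Data.Maybe using (Maybe; just; nothing) renaming (map to mapMaybe)
open import Data.Nat.Divisibility using (divides; _∣?_)
import Data.Nat.ListAction as List
open import Data.Nat.ListAction.Properties using (sum-++)
open import Data.Nat.Tactic.RingSolver using (solve-∀)
open import Data.Product using (∃; ∃-syntax; _×_; _,_)
open import Data.Sum using (_⊎_; inj₁; inj₂)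
open import Data.Vec.Functional using (Vector; toList; updateAt; rearrange) renaming (_∷_ to _◂_)
open import Function using (_∘_; const)
open import Function.Bundles using (_⇔_; mk⇔)
import Relation.Binary.Construct.Flip.EqAndOrd as Flip
open import Relation.Binary.PropositionalEquality
open import Relation.Nullary using (yes; no; ¬?; contradiction; _×-dec_)
open import Data.List.Sort (Flip.decTotalOrder ≤-decTotalOrder) using (sort-↭; sort-↗)

private
  variable
    n k s : ℕ
    xs ys : List ℕ

-- Subsets as bit vectors, and sets of largest entries.

Mask : ℕ → Set
Mask n = Vector (Fin 2) n

∣_∣ : Mask n → ℕ
∣ u ∣ = sum (toℕ ∘ u)

infixl 7 _∙_

_∙_ : Mask n → Vector ℕ n → ℕ
u ∙ b = sum (λ i → toℕ (u i) * b i)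

sum-mono : {f g : Vector ℕ n} → (∀ i → f i ≤ g i) → sum f ≤ sum g
sum-mono {zero}  f≤g = z≤n
sum-mono {suc n} f≤g = +-mono-≤ (f≤g 0F) (sum-mono (f≤g ∘ suc))

sum-mono₂ : (f g h k : Vector ℕ n) → (∀ i → f i + g i ≤ h i + k i) →
            sum f + sum g ≤ sum h + sum k
sum-mono₂ f g h k le = subst₂ _≤_ (∑-distrib-+ f g) (∑-distrib-+ h k) (sum-mono le)

bit≤1 : (x : Fin 2) → toℕ x ≤ 1
bit≤1 0F = z≤n
bit≤1 1F = s≤s z≤n

∣u∣≤n : (u : Mask n) → ∣ u ∣ ≤ n
∣u∣≤n {zero}  u = z≤n
∣u∣≤n {suc n} u = +-mono-≤ (bit≤1 (u 0F)) (∣u∣≤n (u ∘ suc))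

∣u∣≡n⇐ones : (u : Mask n) → (∀ i → u i ≡ 1F) → ∣ u ∣ ≡ n
∣u∣≡n⇐ones {zero}  u ones = refl
∣u∣≡n⇐ones {suc n} u ones rewrite ones 0F = cong suc (∣u∣≡n⇐ones (u ∘ suc) (ones ∘ suc))

switchOn : Mask n → Fin n → Mask n
switchOn u i = updateAt u i (const 1F)

∣switchOn∣ : (u : Mask n) (i : Fin n) → u i ≡ 0F → ∣ switchOn u i ∣ ≡ suc ∣ u ∣
∣switchOn∣ u zero    ui≡0 rewrite ui≡0 = refl
∣switchOn∣ u (suc i) ui≡0 = trans
  (cong (toℕ (u 0F) +_) (∣switchOn∣ (u ∘ suc) i ui≡0)) (+-suc _ _)

-- Replaces the case distinction whether `j` equals `i`, on which `switchOn u i j` does not compute.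
-- The predicate sees the bit as well, so at `i` only `1F` has to be covered.
switchOn-elim : (P : Fin n → Fin 2 → Set) (u : Mask n) (i : Fin n) →
                (∀ j → P j (u j)) → P i 1F → ∀ j → P j (switchOn u i j)
switchOn-elim P u zero    Pu Pi zero    = Pi
switchOn-elim P u zero    Pu Pi (suc j) = Pu (suc j)
switchOn-elim P u (suc i) Pu Pi zero    = Pu zero
switchOn-elim P u (suc i) Pu Pi (suc j) =
  switchOn-elim (P ∘ suc) (u ∘ suc) i (Pu ∘ suc) Pi j

largest-off : (f : Vector ℕ n) (t : Mask n) →
              (∀ i → t i ≡ 1F) ⊎ (∃[ j ] t j ≡ 0F × (∀ i → t i ≡ 0F → f i ≤ f j))
largest-off {zero}  f t = inj₁ λ ()
largest-off {suc n} f t with largest-off (f ∘ suc) (t ∘ suc) | t 0F in t₀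
... | inj₁ ones | 1F = inj₁ λ { zero → t₀ ; (suc i) → ones i }
... | inj₁ ones | 0F = inj₂ (0F , t₀ , λ
  { zero    _    → ≤-refl
  ; (suc i) ti≡0 → contradiction (trans (sym ti≡0) (ones i)) λ () })
... | inj₂ (j , tj≡0 , max) | 1F = inj₂ (suc j , tj≡0 , λ
  { zero    t₀≡0 → contradiction (trans (sym t₀≡0) t₀) λ ()
  ; (suc i) ti≡0 → max i ti≡0 })
... | inj₂ (j , tj≡0 , max) | 0F with ≤-total (f 0F) (f (suc j))
... | inj₁ f₀≤fj = inj₂ (suc j , tj≡0 , λ
  { zero    _    → f₀≤fj
  ; (suc i) ti≡0 → max i ti≡0 })
... | inj₂ fj≤f₀ = inj₂ (0F , t₀ , λ
  { zero    _    → ≤-refl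
  ; (suc i) ti≡0 → ≤-trans (max i ti≡0) fj≤f₀ })

maximum : (f : Vector ℕ (suc n)) → ∃[ j ] (∀ i → f i ≤ f j)
maximum f with largest-off f (const 0F)
... | inj₁ ones          = contradiction (ones 0F) λ ()
... | inj₂ (j , _ , max) = j , λ i → max i refl

Top : Vector ℕ n → Mask n → Set
Top f t = ∀ i j → t i ≡ 1F → t j ≡ 0F → f j ≤ f i

top : (f : Vector ℕ n) (k : ℕ) → k ≤ n → ∃[ t ] ∣ t ∣ ≡ k × Top f t
top {n} f zero    _   = const 0F , sum-replicate-zero n , λ i j ()
top f (suc k) k<n with top f k (<⇒≤ k<n)
... | t , ∣t∣≡k , t-top with largest-off f t
... | inj₁ ones = contradiction (trans (sym ∣t∣≡k) (∣u∣≡n⇐ones t ones)) (<⇒≢ k<n)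
... | inj₂ (j , tj≡0 , max) =
  -- A member of the enlarged set is an old member, dominating everything off `t`, or `j` itself,
  -- chosen largest off `t`.
  switchOn t j , trans (∣switchOn∣ t j tj≡0) (cong suc ∣t∣≡k) , λ i i′ i∈ i′∉ →
    switchOn-elim (λ i b → b ≡ 1F → f i′ ≤ f i) t j
      (λ i i∈t → t-top i i′ i∈t (off i′ i′∉)) (λ _ → max i′ (off i′ i′∉)) i i∈
  where
  off : ∀ i → switchOn t j i ≡ 0F → t i ≡ 0F
  off = switchOn-elim (λ i b → b ≡ 0F → t i ≡ 0F) t j (λ _ → λ eq → eq) λ ()

-- The symmetric Gale-Ryser theorem: necessity of the cut inequalities.

-- The Gale–Ryser inequalities in cut form, over all sets of rows u and of
-- columns v, which makes sorting unnecessary.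
Ryser : Vector ℕ n → Set
Ryser b = ∀ u v → u ∙ b + v ∙ b ≤ ∣ u ∣ * ∣ v ∣ + sum b

record Realisable (b : Vector ℕ n) : Set where
  constructor realisation
  field
    matrix    : Matrix n
    symmetric : ∀ i j → matrix i j ≡ matrix j i
    rowSum    : ∀ i → sum (λ j → toℕ (matrix i j)) ≡ b i

-- For bits, xy + z - xz - yz = (1 - x)(1 - y)z + xy(1 - z) is nonnegative. Summation over all
-- entries z of the matrix gives the inequality; symmetry lets `v ∙ b` be read as a sum over
-- columns.
realisable⇒Ryser : {b : Vector ℕ n} → Realisable b → Ryser b
realisable⇒Ryser {n} {b} (realisation A A-sym A-row) u v = begin
  u ∙ b + v ∙ b
    ≡⟨ cong (u ∙ b +_) columns ⟨
  u ∙ b + sum (λ i → sum (λ j → toℕ (v j) * a i j))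
    ≤⟨ sum-mono₂ _ _ _ _ row ⟩
  sum (λ i → toℕ (u i) * ∣ v ∣) + sum b
    ≡⟨ cong (_+ sum b) (*-distribʳ-sum ∣ v ∣ (toℕ ∘ u)) ⟨
  ∣ u ∣ * ∣ v ∣ + sum b ∎
  where
  open ≤-Reasoning

  a : Fin n → Fin n → ℕ
  a i j = toℕ (A i j)

  columns : sum (λ i → sum (λ j → toℕ (v j) * a i j)) ≡ v ∙ b
  columns = trans (∑-comm (λ i j → toℕ (v j) * a i j)) (sum-cong-≗ λ j →
    trans (sym (*-distribˡ-sum (toℕ (v j)) (λ i → a i j)))
      (cong (toℕ (v j) *_) (trans (sum-cong-≗ λ i → cong toℕ (A-sym i j)) (A-row j))))

  cell : (x y z : Fin 2) → toℕ x * toℕ z + toℕ y * toℕ z ≤ toℕ x * toℕ y + toℕ z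
  cell 0F 0F z  = z≤n
  cell 0F 1F z  = ≤-reflexive (+-identityʳ _)
  cell 1F 0F z  = ≤-reflexive (trans (+-identityʳ _) (+-identityʳ _))
  cell 1F 1F 0F = z≤n
  cell 1F 1F 1F = ≤-refl

  row : ∀ i → toℕ (u i) * b i + sum (λ j → toℕ (v j) * a i j) ≤ toℕ (u i) * ∣ v ∣ + b i
  row i = subst₂ _≤_
    (cong (_+ sum (λ j → toℕ (v j) * a i j))
      (trans (sym (*-distribˡ-sum (toℕ (u i)) (a i))) (cong (toℕ (u i) *_) (A-row i))))
    (cong₂ _+_ (sym (*-distribˡ-sum (toℕ (u i)) (toℕ ∘ v))) (A-row i))
    (sum-mono₂ _ _ _ _ λ j → cell (u i) (v j) (A i j))

-- Sufficiency of the cut inequalities: deletion of a vertex of maximal degree.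

infixr 6 _∧_

_∧_ : Fin 2 → Fin 2 → Fin 2
0F ∧ y = 0F
1F ∧ y = y


-- `sgn ∘ f` is the support of `f` as a mask.
sgn : ℕ → Fin 2
sgn zero    = 0F
sgn (suc _) = 1F

sgn-* : ∀ x → toℕ (sgn x) * x ≡ x
sgn-* zero    = refl
sgn-* (suc x) = +-identityʳ (suc x)

-- Take the head alone as rows, and the head with the support of `f` as columns: all other terms
-- cancel. Hence there are enough vertices of positive degree for the `e` neighbours that the head
-- needs besides its loop.
ryser-head : {e : ℕ} {f : Vector ℕ n} → Ryser (suc e ◂ f) → e ≤ ∣ sgn ∘ f ∣
ryser-head {n} {e} {f} ryser =
  +-cancelˡ-≤ (suc (suc (e + sum f))) _ _ (subst₂ _≤_ lhs rhs (ryser (1F ◂ const 0F) (1F ◂ sgn ∘ f)))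
  where
  lhs : (suc e + 0 + (const 0F ∙ f)) + (suc e + 0 + (sgn ∘ f) ∙ f) ≡ suc (suc (e + sum f)) + e
  lhs rewrite sum-replicate-zero n | sum-cong-≗ (sgn-* ∘ f) = lemma e (sum f)
    where
    lemma : ∀ e s → (suc e + 0 + 0) + (suc e + 0 + s) ≡ suc (suc (e + s)) + e
    lemma = solve-∀
  rhs : (1 + ∣ const {B = Fin n} 0F ∣) * (1 + ∣ sgn ∘ f ∣) + (suc e + sum f) ≡
        suc (suc (e + sum f)) + ∣ sgn ∘ f ∣
  rhs rewrite sum-replicate-zero n = lemma e (sum f) ∣ sgn ∘ f ∣
    where
    lemma : ∀ e s k → (1 + 0) * (1 + k) + (suc e + s) ≡ suc (suc (e + s)) + k
    lemma = solve-∀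

-- Deleting the vertex of degree 1 + e, joined to itself and to the e largest
-- remaining vertices t.
module Deletion
  (f : Vector ℕ n) (e : ℕ) (f≤ : ∀ i → f i ≤ suc e) (ryser : Ryser (suc e ◂ f))
  (t : Mask n) (∣t∣≡e : ∣ t ∣ ≡ e) (t-top : Top f t)
  where

  -- If a member of t vanished, then so would f off t, and the support of f
  -- would have fewer than e elements.
  t⇒positive : ∀ i → t i ≡ 1F → 1 ≤ f i
  t⇒positive i ti≡1 with f i in fi≡
  ... | suc _ = s≤s z≤n
  ... | zero  = contradiction support<e (≤⇒≯ (ryser-head ryser))
    where
    open ≤-Reasoning
    support≤t : ∀ j → toℕ (sgn (f j)) ≤ toℕ (t j)
    support≤t j with t j in tj≡
    ... | 1F = bit≤1 _
    ... | 0F rewrite n≤0⇒n≡0 (subst (f j ≤_) fi≡ (t-top i j ti≡1 tj≡)) = z≤n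
    support<e : ∣ sgn ∘ f ∣ < e
    support<e = begin-strict
      ∣ sgn ∘ f ∣              <⟨ n<1+n _ ⟩
      suc ∣ sgn ∘ f ∣          ≡⟨ ∣switchOn∣ (sgn ∘ f) i (cong sgn fi≡) ⟨
      ∣ switchOn (sgn ∘ f) i ∣ ≤⟨ sum-mono (switchOn-elim (λ j b → toℕ b ≤ toℕ (t j)) (sgn ∘ f) i
                                    support≤t (≤-reflexive (cong toℕ (sym ti≡1)))) ⟩
      ∣ t ∣                    ≡⟨ ∣t∣≡e ⟩
      e                        ∎

  rest : Vector ℕ n
  rest i = f i ∸ toℕ (t i)

  t+rest : ∀ i → toℕ (t i) + rest i ≡ f i
  t+rest i = m+[n∸m]≡n t≤f
    where
    t≤f : toℕ (t i) ≤ f i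
    t≤f with t i in ti≡
    ... | 0F = z≤n
    ... | 1F = t⇒positive i ti≡

  e+∑rest : e + sum rest ≡ sum f
  e+∑rest = trans (cong (_+ sum rest) (sym ∣t∣≡e))
    (trans (sym (∑-distrib-+ (toℕ ∘ t) rest)) (sum-cong-≗ t+rest))

  Cut : Mask n → Mask n → Set
  Cut u v = u ∙ rest + v ∙ rest ≤ ∣ u ∣ * ∣ v ∣ + sum rest

  Cut-sym : ∀ u v → Cut u v → Cut v u
  Cut-sym u v = subst₂ _≤_ (+-comm (u ∙ rest) _) (cong (_+ sum rest) (*-comm ∣ u ∣ _))

  within : Mask n → Mask n
  within u i = u i ∧ t i

  ∙-within : ∀ u → within u ∙ f ≡ ∣ within u ∣ + within u ∙ rest
  ∙-within u = trans (sum-cong-≗ λ i → cell (u i) i) (∑-distrib-+ (toℕ ∘ within u) _)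
    where
    cell : ∀ x i → toℕ (x ∧ t i) * f i ≡ toℕ (x ∧ t i) + toℕ (x ∧ t i) * rest i
    cell 0F i = refl
    cell 1F i with t i | t+rest i
    ... | 0F | _  = refl
    ... | 1F | eq = trans (+-identityʳ _) (trans (sym eq) (cong suc (sym (+-identityʳ _))))

  -- The deleted vertex is put into both sets. Inside `t` every degree drops by exactly one, and
  -- these drops match the cross terms of `(1 + ∣ u′ ∣) * (1 + ∣ v′ ∣)`, so the inequality loses
  -- nothing.
  cut-inside : (u v : Mask n) → Cut (within u) (within v)
  cut-inside u v = +-cancelˡ-≤ (2 + (e + e + (∣ u′ ∣ + ∣ v′ ∣))) _ _
    (subst₂ _≤_ lhs rhs (ryser (1F ◂ u′) (1F ◂ v′)))
    where
    u′ v′ : Mask n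
    u′ = within u
    v′ = within v
    lhs : (suc e + 0 + u′ ∙ f) + (suc e + 0 + v′ ∙ f) ≡
          2 + (e + e + (∣ u′ ∣ + ∣ v′ ∣)) + (u′ ∙ rest + v′ ∙ rest)
    lhs rewrite ∙-within u | ∙-within v = lemma e ∣ u′ ∣ ∣ v′ ∣ (u′ ∙ rest) (v′ ∙ rest)
      where
      lemma : ∀ e p q x y → (suc e + 0 + (p + x)) + (suc e + 0 + (q + y)) ≡
              2 + (e + e + (p + q)) + (x + y)
      lemma = solve-∀
    rhs : (1 + ∣ u′ ∣) * (1 + ∣ v′ ∣) + (suc e + sum f) ≡
          2 + (e + e + (∣ u′ ∣ + ∣ v′ ∣)) + (∣ u′ ∣ * ∣ v′ ∣ + sum rest)
    rhs rewrite sym e+∑rest = lemma e ∣ u′ ∣ ∣ v′ ∣ (sum rest)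
      where
      lemma : ∀ e p q s → (1 + p) * (1 + q) + (suc e + (e + s)) ≡
              2 + (e + e + (p + q)) + (p * q + s)
      lemma = solve-∀

  -- Then rest is at least ∣ v ∣ at 1 + e places, whereas it is at most 1 + e
  -- everywhere on v.
  cut-small : ∀ u v {j} → t j ≡ 0F → ∣ v ∣ < f j → Cut u v
  cut-small u v {j} tj≡0 v<fj = begin
    u ∙ rest + v ∙ rest
      ≤⟨ +-monoʳ-≤ (u ∙ rest) (sum-mono λ i → *-monoʳ-≤ (toℕ (v i)) (≤-trans (m∸n≤m (f i) (toℕ (t i))) (f≤ i))) ⟩
    u ∙ rest + sum (λ i → toℕ (v i) * suc e)
      ≡⟨ cong (u ∙ rest +_) (*-distribʳ-sum (suc e) (toℕ ∘ v)) ⟨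
    u ∙ rest + ∣ v ∣ * suc e
      ≡⟨ cong (λ k → u ∙ rest + ∣ v ∣ * k) (trans (∣switchOn∣ t j tj≡0) (cong suc ∣t∣≡e)) ⟨
    u ∙ rest + ∣ v ∣ * ∣ w ∣
      ≡⟨ cong (u ∙ rest +_) (*-distribˡ-sum ∣ v ∣ (toℕ ∘ w)) ⟩
    u ∙ rest + sum (λ i → ∣ v ∣ * toℕ (w i))
      ≤⟨ sum-mono₂ _ _ _ _ (λ i → cell (u i) (w i) (w⇒large i)) ⟩
    sum (λ i → toℕ (u i) * ∣ v ∣) + sum rest
      ≡⟨ cong (_+ sum rest) (*-distribʳ-sum ∣ v ∣ (toℕ ∘ u)) ⟨
    ∣ u ∣ * ∣ v ∣ + sum rest ∎
    where
    open ≤-Reasoning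
    w : Mask n
    w = switchOn t j
    w⇒large : ∀ i → w i ≡ 1F → ∣ v ∣ ≤ rest i
    -- A member of `t` loses one, which the strict inequality `∣ v ∣ < f j` pays for; `j` lies off
    -- `t` and loses nothing.
    w⇒large = switchOn-elim (λ i b → b ≡ 1F → ∣ v ∣ ≤ rest i) t j
      (λ i ti≡1 → subst (λ b → ∣ v ∣ ≤ f i ∸ toℕ b) (sym ti≡1)
        (∸-monoˡ-≤ 1 (≤-trans v<fj (t-top i j ti≡1 tj≡0))))
      (λ _ → subst (λ b → ∣ v ∣ ≤ f j ∸ toℕ b) (sym tj≡0) (<⇒≤ v<fj))
    cell : ∀ x y {q r} → (y ≡ 1F → q ≤ r) → toℕ x * r + q * toℕ y ≤ toℕ x * q + r
    cell 0F 0F {q}     q≤r rewrite *-zeroʳ q = z≤n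
    cell 0F 1F {q}     q≤r rewrite *-identityʳ q = q≤r refl
    cell 1F 0F {q} {r} q≤r rewrite *-zeroʳ q | +-identityʳ r | +-identityʳ r = m≤n+m r _
    cell 1F 1F {q} {r} q≤r rewrite *-identityʳ q | +-identityʳ r | +-identityʳ q = ≤-reflexive (+-comm r q)

  -- A row of u off t contributes at most ∣ v ∣ on the left of the inequality and
  -- exactly ∣ v ∣ on the right.
  cut-large : ∀ u v → (∀ i → t i ≡ 0F → f i ≤ ∣ v ∣) → Cut (within u) v → Cut u v
  cut-large u v f≤v cut = +-cancelʳ-≤ (∣ u′ ∣ * ∣ v ∣ + u′ ∙ rest) _ _
    (subst₂ _≤_
      (lemma₁ (u ∙ rest) (∣ u′ ∣ * ∣ v ∣) (u′ ∙ rest) (v ∙ rest))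
      (lemma₂ (u′ ∙ rest) (∣ u ∣ * ∣ v ∣) (∣ u′ ∣ * ∣ v ∣) (sum rest))
      (+-mono-≤ shrink cut))
    where
    u′ : Mask n
    u′ = within u
    lemma₁ : ∀ a b c d → (a + b) + (c + d) ≡ (a + d) + (b + c)
    lemma₁ = solve-∀
    lemma₂ : ∀ a b c d → (a + b) + (c + d) ≡ (b + d) + (c + a)
    lemma₂ = solve-∀
    cell : ∀ x i → toℕ x * rest i + toℕ (x ∧ t i) * ∣ v ∣ ≤ toℕ (x ∧ t i) * rest i + toℕ x * ∣ v ∣
    cell 0F i = z≤n
    cell 1F i with t i in ti≡
    ... | 1F = ≤-refl
    ... | 0F rewrite +-identityʳ (f i) | +-identityʳ (f i) | +-identityʳ ∣ v ∣ = f≤v i ti≡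
    shrink : u ∙ rest + ∣ u′ ∣ * ∣ v ∣ ≤ u′ ∙ rest + ∣ u ∣ * ∣ v ∣
    shrink = subst₂ _≤_
      (cong (u ∙ rest +_) (sym (*-distribʳ-sum ∣ v ∣ (toℕ ∘ u′))))
      (cong (u′ ∙ rest +_) (sym (*-distribʳ-sum ∣ v ∣ (toℕ ∘ u))))
      (sum-mono₂ _ _ _ _ λ i → cell (u i) i)

  -- If some degree off `t` exceeds `∣ v ∣`, the cut inequality holds outright; otherwise the rows
  -- of `u` off `t` can be restored without harm.
  cut-shrink : ∀ u v → Cut (within u) v → Cut u v
  cut-shrink u v cut with any? (λ j → (t j ≟ᶠ 0F) ×-dec (∣ v ∣ <? f j))
  ... | yes (j , tj≡0 , v<fj) = cut-small u v tj≡0 v<fj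
  ... | no  none = cut-large u v (λ i ti≡0 → ≮⇒≥ λ v<fi → none (i , ti≡0 , v<fi)) cut

  -- Both sets are reduced to their parts in `t`, one after the other, with `Cut-sym` exchanging
  -- their roles, until `cut-inside` applies.
  rest-ryser : Ryser rest
  rest-ryser u v = cut-shrink u v (Cut-sym v u′ (cut-shrink v u′ (Cut-sym u′ v′ (cut-inside u v))))
    where
    u′ v′ : Mask n
    u′ = within u
    v′ = within v

  extend : Realisable rest → Realisable (suc e ◂ f)
  extend (realisation A A-sym A-row) = realisation B B-sym B-row
    where
    B : Matrix (suc n)
    -- The loop supplies the one unit of `suc e` that the `e` members of `t` leave over.
    B zero    zero    = 1F
    B zero    (suc j) = t j
    B (suc i) zero    = t i
    B (suc i) (suc j) = A i j
    B-sym : ∀ i j → B i j ≡ B j i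
    B-sym zero    zero    = refl
    B-sym zero    (suc j) = refl
    B-sym (suc i) zero    = refl
    B-sym (suc i) (suc j) = A-sym i j
    B-row : ∀ i → sum (λ j → toℕ (B i j)) ≡ (suc e ◂ f) i
    B-row zero    = cong suc ∣t∣≡e
    B-row (suc i) = trans (cong (toℕ (t i) +_) (A-row i)) (t+rest i)

-- Induction on the number of vertices.

realise-zeros : {b : Vector ℕ n} → (∀ i → b i ≤ 0) → Realisable b
realise-zeros {n} b≤0 = realisation (λ _ _ → 0F) (λ _ _ → refl) λ i →
  trans (sum-replicate-zero n) (sym (n≤0⇒n≡0 (b≤0 i)))

realise-step : (∀ f → Ryser {n} f → Realisable f) → ∀ d (f : Vector ℕ n) → (∀ i → f i ≤ d) →
               Ryser (d ◂ f) → Realisable (d ◂ f)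
realise-step ih zero    f f≤ ryser = realise-zeros λ { zero → z≤n ; (suc i) → f≤ i }
realise-step ih (suc e) f f≤ ryser with top f e (≤-trans (ryser-head ryser) (∣u∣≤n (sgn ∘ f)))
... | t , ∣t∣≡e , t-top = extend (ih rest rest-ryser)
  where open Deletion f e f≤ ryser t ∣t∣≡e t-top

ryser-permute : {b : Vector ℕ n} (π : Permutation′ n) → Ryser b → Ryser (rearrange (π ⟨$⟩ʳ_) b)
ryser-permute {n} {b} π ryser u v = subst₂ _≤_
  (cong₂ _+_ (∙-permute u) (∙-permute v))
  (cong₂ _+_ (cong₂ _*_ (∣∣-permute u) (∣∣-permute v)) (sum-permute b π))
  (ryser (back u) (back v))
  where
  back : Mask n → Mask n
  back u = rearrange (π ⟨$⟩ˡ_) u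
  ∙-permute : ∀ u → back u ∙ b ≡ u ∙ rearrange (π ⟨$⟩ʳ_) b
  ∙-permute u = trans (sum-permute _ π) (sum-cong-≗ λ i →
    cong (λ k → toℕ (u k) * b (π ⟨$⟩ʳ i)) (Perm.inverseˡ π))
  ∣∣-permute : ∀ u → ∣ back u ∣ ≡ ∣ u ∣
  ∣∣-permute u = sym (sum-permute (toℕ ∘ u) (Perm.flip π))

realisable-permute : {b : Vector ℕ n} (π : Permutation′ n) →
                     Realisable (rearrange (π ⟨$⟩ʳ_) b) → Realisable b
realisable-permute {b = b} π (realisation A A-sym A-row) = realisation
  (λ i j → A (π ⟨$⟩ˡ i) (π ⟨$⟩ˡ j)) (λ i j → A-sym _ _)
  λ i → trans (sym (sum-permute (λ j → toℕ (A (π ⟨$⟩ˡ i) j)) (Perm.flip π)))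
    (trans (A-row _) (cong b (Perm.inverseʳ π)))

-- A transposition brings a vertex of maximal degree to the front; permuting rows and columns
-- simultaneously keeps the matrix symmetric, so it can be undone afterwards.
realise : (b : Vector ℕ n) → Ryser b → Realisable b
realise {zero}  b ryser = realisation (λ ()) (λ ()) (λ ())
realise {suc n} b ryser with maximum b
... | x , max = realisable-permute {b = b} π (cons-η
    (realise-step realise (b x) (c ∘ suc) (λ i → max _) (ryser-permute {b = b} π ryser)))
  where
  π : Permutation′ (suc n)
  π = Perm.transpose 0F x
  c : Vector ℕ (suc n)
  c = rearrange (π ⟨$⟩ʳ_) b
  -- `c` and its head-and-tail form agree only pointwise, so the row sums need a case split.
  cons-η : Realisable (b x ◂ c ∘ suc) → Realisable c
  cons-η (realisation A A-sym A-row) = realisation A A-sym λ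
    { zero → A-row zero ; (suc i) → A-row (suc i) }

-- Subset sums and prefixes of sorted lists.

-- Links masks on a vector with prefixes of its sorted list: since only the number of kept entries
-- and their sum are recorded, a pick survives any permutation of the list.
data Pick : ℕ → ℕ → List ℕ → Set where
  []   : Pick 0 0 []
  skip : ∀ {x} → Pick k s xs → Pick k s (x ∷ xs)
  keep : ∀ {x} → Pick k s xs → Pick (suc k) (x + s) (x ∷ xs)

pick-cong : ∀ {s s′} → s ≡ s′ → Pick k s xs → Pick k s′ xs
pick-cong refl p = p

pick-↭ : xs ↭ ys → Pick k s xs → Pick k s ys
pick-↭ ↭.refl        p               = p
pick-↭ (↭.prep x σ)   (skip p)        = skip (pick-↭ σ p)
pick-↭ (↭.prep x σ)   (keep p)        = keep (pick-↭ σ p)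
pick-↭ (↭.swap x y σ) (skip (skip p)) = skip (skip (pick-↭ σ p))
pick-↭ (↭.swap x y σ) (skip (keep p)) = keep (skip (pick-↭ σ p))
pick-↭ (↭.swap x y σ) (keep (skip p)) = skip (keep (pick-↭ σ p))
pick-↭ (↭.swap x y σ) (keep (keep p)) =
  pick-cong (exchange y x _) (keep (keep (pick-↭ σ p)))
  where
  exchange : ∀ x y z → x + (y + z) ≡ y + (x + z)
  exchange = solve-∀
pick-↭ (↭.trans σ τ)  p               = pick-↭ τ (pick-↭ σ p)

mask⇒pick : (u : Mask n) (b : Vector ℕ n) → Pick ∣ u ∣ (u ∙ b) (toList b)
mask⇒pick {zero}  u b = []
mask⇒pick {suc n} u b with u 0F
... | 0F = skip (mask⇒pick (u ∘ suc) (b ∘ suc))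
... | 1F = pick-cong (cong (_+ (u ∘ suc) ∙ (b ∘ suc)) (sym (+-identityʳ (b 0F)))) (keep (mask⇒pick (u ∘ suc) (b ∘ suc)))

pick⇒mask : (b : Vector ℕ n) → Pick k s (toList b) → ∃[ u ] ∣ u ∣ ≡ k × u ∙ b ≡ s
pick⇒mask {zero}  b []       = (λ ()) , refl , refl
pick⇒mask {suc n} b (skip p) with pick⇒mask (b ∘ suc) p
... | u , ∣u∣≡k , u∙b≡s = 0F ◂ u , ∣u∣≡k , u∙b≡s
pick⇒mask {suc n} b (keep p) with pick⇒mask (b ∘ suc) p
... | u , ∣u∣≡k , u∙b≡s = 1F ◂ u , cong suc ∣u∣≡k , cong₂ _+_ (+-identityʳ (b 0F)) u∙b≡s

take-tail : ∀ {x} k → Linked _≥_ (x ∷ xs) → List.sum (take k xs) ≤ List.sum (take k (x ∷ xs))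
take-tail zero    _            = z≤n
take-tail (suc k) [-]          = z≤n
take-tail (suc k) (x≥y ∷ desc) = +-mono-≤ x≥y (take-tail k desc)

pick≤take : Linked _≥_ xs → Pick k s xs → s ≤ List.sum (take k xs)
pick≤take desc []       = z≤n
pick≤take {k = k} desc (skip p) = ≤-trans (pick≤take (tail desc) p) (take-tail k desc)
pick≤take desc (keep p) = +-monoʳ-≤ _ (pick≤take (tail desc) p)

-- The number picked falls short of `ℓ` when the list ends early. The inequality suffices because
-- `b i ⊓ k` grows with `k`.
take-pick : ∀ ℓ xs → ∃[ k ] k ≤ ℓ × Pick k (List.sum (take ℓ xs)) xs
take-pick ℓ       []       = 0 , z≤n , pick-cong (cong List.sum (sym (take-[] ℓ))) []
take-pick zero    (x ∷ xs) with take-pick zero xs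
... | k , k≤ , p = k , k≤ , skip p
take-pick (suc ℓ) (x ∷ xs) with take-pick ℓ xs
... | k , k≤ , p = suc k , s≤s k≤ , keep p

-- Partial sums of the conjugate partition.

-- The component of the conjugate at 0-based position `k`, free of the cut-off at `max 0 xs`.
countFrom : List ℕ → ℕ → ℕ
countFrom xs k = length (filter (suc k ≤?_) xs)

countFrom-accept : ∀ {x} xs {k} → k < x → countFrom (x ∷ xs) k ≡ suc (countFrom xs k)
countFrom-accept xs {k} k<x = cong length (filter-accept (suc k ≤?_) {xs = xs} k<x)

countFrom-reject : ∀ {x} xs {k} → x ≤ k → countFrom (x ∷ xs) k ≡ countFrom xs k
countFrom-reject xs {k} x≤k = cong length (filter-reject (suc k ≤?_) {xs = xs} (≤⇒≯ x≤k))

-- Raising the cap from `ℓ` to `suc ℓ` gains one at each entry above `ℓ` and nothing elsewhere.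
countFrom-⊓ : ∀ xs ℓ → List.sum (map (_⊓ suc ℓ) xs) ≡ List.sum (map (_⊓ ℓ) xs) + countFrom xs ℓ
countFrom-⊓ []       ℓ = refl
countFrom-⊓ (x ∷ xs) ℓ with ≤-<-connex x ℓ
... | inj₁ x≤ℓ rewrite countFrom-reject xs x≤ℓ | m≤n⇒m⊓n≡m (m≤n⇒m≤1+n x≤ℓ) | m≤n⇒m⊓n≡m x≤ℓ
                     | countFrom-⊓ xs ℓ = sym (+-assoc x _ _)
... | inj₂ ℓ<x rewrite countFrom-accept xs ℓ<x | m≥n⇒m⊓n≡n ℓ<x | m≥n⇒m⊓n≡n (<⇒≤ ℓ<x)
                     | countFrom-⊓ xs ℓ = lemma ℓ _ (countFrom xs ℓ)
  where
  lemma : ∀ a b c → suc a + (b + c) ≡ a + b + suc c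
  lemma = solve-∀

-- The boxes in the first `ℓ` columns of the Young diagram, counted by columns and by rows.
sum-countFrom : ∀ xs ℓ → List.sum (applyUpTo (countFrom xs) ℓ) ≡ List.sum (map (_⊓ ℓ) xs)
sum-countFrom xs zero    = sym (zeros xs)
  where
  zeros : ∀ xs → List.sum (map (_⊓ 0) xs) ≡ 0
  zeros []       = refl
  zeros (x ∷ xs) rewrite ⊓-zeroʳ x = zeros xs
sum-countFrom xs (suc ℓ) = begin
  List.sum (applyUpTo (countFrom xs) (suc ℓ))
    ≡⟨ cong List.sum (applyUpTo-∷ʳ (countFrom xs) ℓ) ⟨
  List.sum (applyUpTo (countFrom xs) ℓ ++ (countFrom xs ℓ ∷ []))
    ≡⟨ sum-++ (applyUpTo (countFrom xs) ℓ) _ ⟩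
  List.sum (applyUpTo (countFrom xs) ℓ) + (countFrom xs ℓ + 0)
    ≡⟨ cong₂ _+_ (sum-countFrom xs ℓ) (+-identityʳ _) ⟩
  List.sum (map (_⊓ ℓ) xs) + countFrom xs ℓ
    ≡⟨ countFrom-⊓ xs ℓ ⟨
  List.sum (map (_⊓ suc ℓ) xs) ∎
  where open ≡-Reasoning

take-applyUpTo : ∀ {A : Set} (f : ℕ → A) ℓ N → take ℓ (applyUpTo f N) ≡ applyUpTo f (ℓ ⊓ N)
take-applyUpTo f zero    N       = refl
take-applyUpTo f (suc ℓ) zero    = refl
take-applyUpTo f (suc ℓ) (suc N) = cong (f 0 ∷_) (take-applyUpTo (f ∘ suc) ℓ N)

conjugate-descending : ∀ xs → Linked _≥_ (conjugate xs)
conjugate-descending xs = applyUpTo⁺₂ (countFrom xs) _ (antitone xs)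
  where
  antitone : ∀ xs k → countFrom xs k ≥ countFrom xs (suc k)
  antitone []       k = z≤n
  antitone (x ∷ xs) k with ≤-<-connex x k | ≤-<-connex x (suc k)
  ... | inj₁ x≤k | _ rewrite countFrom-reject xs x≤k | countFrom-reject xs (m≤n⇒m≤1+n x≤k) = antitone xs k
  ... | inj₂ k<x | inj₁ x≤k rewrite countFrom-accept xs k<x | countFrom-reject xs x≤k = m≤n⇒m≤1+n (antitone xs k)
  ... | inj₂ k<x | inj₂ 1+k<x rewrite countFrom-accept xs k<x | countFrom-accept xs 1+k<x = s≤s (antitone xs k)

sort-conjugate : ∀ xs → sortDescending (conjugate xs) ≡ conjugate xs
sort-conjugate xs = ≋⇒≡ (↗↭↗⇒≋ (Flip.totalOrder ≤-totalOrder)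
  (sort-↗ (conjugate xs)) (conjugate-descending xs) (↭⇒↭ₛ (sort-↭ (conjugate xs))))

take-conjugate : ∀ xs ℓ → List.sum (take ℓ (sortDescending (conjugate xs))) ≡ List.sum (map (_⊓ ℓ) xs)
take-conjugate xs ℓ = begin
  List.sum (take ℓ (sortDescending (conjugate xs)))    ≡⟨ cong (List.sum ∘ take ℓ) (sort-conjugate xs) ⟩
  List.sum (take ℓ (conjugate xs))                     ≡⟨ cong List.sum (take-applyUpTo (countFrom xs) ℓ (max 0 xs)) ⟩
  List.sum (applyUpTo (countFrom xs) (ℓ ⊓ max 0 xs))   ≡⟨ sum-countFrom xs (ℓ ⊓ max 0 xs) ⟩
  List.sum (map (_⊓ (ℓ ⊓ max 0 xs)) xs)                ≡⟨ cong List.sum (map-cong-local (All.map drop-max (xs≤max 0 xs))) ⟩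
  List.sum (map (_⊓ ℓ) xs)                             ∎
  where
  open ≡-Reasoning
  -- No entry exceeds `max 0 xs`, so ending the conjugate there loses nothing.
  drop-max : ∀ {x} → x ≤ max 0 xs → x ⊓ (ℓ ⊓ max 0 xs) ≡ x ⊓ ℓ
  drop-max {x} x≤ = trans (sym (⊓-assoc x ℓ _)) (m≤n⇒m⊓n≡m (≤-trans (m⊓n≤m x ℓ) x≤))

sum-conjugate : ∀ xs → List.sum (conjugate xs) ≡ List.sum xs
sum-conjugate xs = trans (sum-countFrom xs (max 0 xs))
  (cong List.sum (map-id-local (All.map m≤n⇒m⊓n≡m (xs≤max 0 xs))))

-- Dominance by the conjugate is equivalent to the cut inequalities.

sum-toList : (f : Vector ℕ n) → List.sum (toList f) ≡ sum f
sum-toList {zero}  f = refl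
sum-toList {suc n} f = cong (f 0F +_) (sum-toList (f ∘ suc))

take-conjugate-toList : (b : Vector ℕ n) (ℓ : ℕ) →
  List.sum (take ℓ (sortDescending (conjugate (toList b)))) ≡ sum (λ i → b i ⊓ ℓ)
take-conjugate-toList b ℓ = trans (take-conjugate (toList b) ℓ)
  (trans (cong List.sum (map-tabulate b (_⊓ ℓ))) (sum-toList (λ i → b i ⊓ ℓ)))

-- No `∣ u ∣` entries exceed the corresponding sorted prefix, which dominance bounds by the sum of
-- all `b i ⊓ ∣ u ∣`. This minimum is at most `∣ u ∣` on `v` and at most `b i` off `v`.
⪯conjugate⇒ryser : (b : Vector ℕ n) → toList b ⪯ conjugate (toList b) → Ryser b
⪯conjugate⇒ryser b (_ , dom) u v = begin
  u ∙ b + v ∙ b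
    ≤⟨ +-monoˡ-≤ (v ∙ b) (pick≤take (sort-↗ (toList b)) (pick-↭ (↭-sym (sort-↭ (toList b))) (mask⇒pick u b))) ⟩
  List.sum (take ∣ u ∣ (sortDescending (toList b))) + v ∙ b
    ≤⟨ +-monoˡ-≤ (v ∙ b) (dom ∣ u ∣) ⟩
  List.sum (take ∣ u ∣ (sortDescending (conjugate (toList b)))) + v ∙ b
    ≡⟨ cong (_+ v ∙ b) (take-conjugate-toList b ∣ u ∣) ⟩
  sum (λ i → b i ⊓ ∣ u ∣) + v ∙ b
    ≤⟨ sum-mono₂ _ _ _ _ (λ i → cell (v i) (b i)) ⟩
  sum (λ i → ∣ u ∣ * toℕ (v i)) + sum b
    ≡⟨ cong (_+ sum b) (*-distribˡ-sum ∣ u ∣ (toℕ ∘ v)) ⟨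
  ∣ u ∣ * ∣ v ∣ + sum b ∎
  where
  open ≤-Reasoning
  cell : ∀ x y → y ⊓ ∣ u ∣ + toℕ x * y ≤ ∣ u ∣ * toℕ x + y
  cell 0F y rewrite *-zeroʳ ∣ u ∣ | +-identityʳ (y ⊓ ∣ u ∣) = m⊓n≤m y _
  cell 1F y rewrite *-identityʳ ∣ u ∣ | +-identityʳ y = +-monoˡ-≤ y (m⊓n≤n y _)

-- Each prefix sum of the sorted list is `u ∙ b` for some mask `u`; the cut inequality for `u` and
-- the best choice of `v` bounds it.
ryser⇒⪯conjugate : (b : Vector ℕ n) → Ryser b → toList b ⪯ conjugate (toList b)
ryser⇒⪯conjugate {n} b ryser = sum-conjugate (toList b) , dom
  where
  open ≤-Reasoning
  bounded : ∀ u → u ∙ b ≤ sum (λ i → b i ⊓ ∣ u ∣)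
  bounded u = +-cancelʳ-≤ (v ∙ b) _ _ (begin
    u ∙ b + v ∙ b                              ≤⟨ ryser u v ⟩
    ∣ u ∣ * ∣ v ∣ + sum b                      ≡⟨ cong (_+ sum b) (*-distribˡ-sum ∣ u ∣ (toℕ ∘ v)) ⟩
    sum (λ i → ∣ u ∣ * toℕ (v i)) + sum b      ≤⟨ sum-mono₂ _ _ _ _ (λ i → cell (b i)) ⟩
    sum (λ i → b i ⊓ ∣ u ∣) + v ∙ b            ∎)
    where
    -- With `v` the places where `b` exceeds `∣ u ∣`, the minimum `b i ⊓ ∣ u ∣` is exactly `∣ u ∣`
    -- on `v` and `b i` off `v`.
    exceeds : ℕ → Fin 2
    exceeds x with ∣ u ∣ <? x
    ... | yes _ = 1F
    ... | no  _ = 0F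
    v : Mask n
    v = exceeds ∘ b
    cell : ∀ x → ∣ u ∣ * toℕ (exceeds x) + x ≤ x ⊓ ∣ u ∣ + toℕ (exceeds x) * x
    cell x with ∣ u ∣ <? x
    ... | yes u<x rewrite *-identityʳ ∣ u ∣ | +-identityʳ x | m≥n⇒m⊓n≡n (<⇒≤ u<x) = ≤-refl
    ... | no  u≮x rewrite *-zeroʳ ∣ u ∣ | m≤n⇒m⊓n≡m (≮⇒≥ u≮x) = m≤m+n x 0

  dom : ∀ ℓ → List.sum (take ℓ (sortDescending (toList b))) ≤
              List.sum (take ℓ (sortDescending (conjugate (toList b))))
  dom ℓ with take-pick ℓ (sortDescending (toList b))
  ... | k , k≤ℓ , p with pick⇒mask b (pick-↭ (sort-↭ (toList b)) p)
  ... | u , refl , u∙b≡s = begin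
    List.sum (take ℓ (sortDescending (toList b)))              ≡⟨ u∙b≡s ⟨
    u ∙ b                                                      ≤⟨ bounded u ⟩
    sum (λ i → b i ⊓ ∣ u ∣)                                    ≤⟨ sum-mono (λ i → ⊓-monoʳ-≤ (b i) k≤ℓ) ⟩
    sum (λ i → b i ⊓ ℓ)                                        ≡⟨ take-conjugate-toList b ℓ ⟨
    List.sum (take ℓ (sortDescending (conjugate (toList b))))  ∎

-- Parities and halves.

parityBit : ℕ → Fin 2
parityBit 0             = 0F
parityBit 1             = 1F
parityBit (suc (suc k)) = parityBit k

halves+parity : ∀ k → ⌊ k /2⌋ + ⌊ k /2⌋ + toℕ (parityBit k) ≡ k
halves+parity 0 = refl
halves+parity 1 = refl
halves+parity (suc (suc k)) = trans (cong (_+ toℕ (parityBit k)) (cong suc (+-suc _ _)))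
  (cong (2 +_) (halves+parity k))

parity-double : ∀ k x → parityBit (k + k + toℕ x) ≡ x
parity-double zero    0F = refl
parity-double zero    1F = refl
parity-double (suc k) x rewrite +-suc k k = parity-double k x

half-double : ∀ k (x : Fin 2) → ⌊ k + k + toℕ x /2⌋ ≡ k
half-double zero    0F = refl
half-double zero    1F = refl
half-double (suc k) x rewrite +-suc k k = cong suc (half-double k x)

even⇒parity : ∀ {k} → Even k → parityBit k ≡ 0F
even⇒parity (divides q refl) = go q
  where
  go : ∀ q → parityBit (q * 2) ≡ 0F
  go zero    = refl
  go (suc q) = go q

parity⇒even : ∀ {k} → parityBit k ≡ 0F → Even k
parity⇒even {k} eq = divides ⌊ k /2⌋ (begin
  k                                            ≡⟨ halves+parity k ⟨
  ⌊ k /2⌋ + ⌊ k /2⌋ + toℕ (parityBit k)        ≡⟨ cong (λ x → ⌊ k /2⌋ + ⌊ k /2⌋ + toℕ x) eq ⟩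
  ⌊ k /2⌋ + ⌊ k /2⌋ + 0                        ≡⟨ lemma ⌊ k /2⌋ ⟩
  ⌊ k /2⌋ * 2                                  ∎)
  where
  open ≡-Reasoning
  lemma : ∀ q → q + q + 0 ≡ q * 2
  lemma = solve-∀

odd⇒parity : ∀ {k} → Odd k → parityBit k ≡ 1F
odd⇒parity {k} odd with parityBit k in eq
... | 0F = contradiction (parity⇒even eq) odd
... | 1F = refl

parity⇒odd : ∀ {k} → parityBit k ≡ 1F → Odd k
parity⇒odd eq even = contradiction (trans (sym eq) (even⇒parity even)) λ ()

oddCount-sum : (R : Vector ℕ n) → oddCount R ≡ ∣ parityBit ∘ R ∣
oddCount-sum {zero}  R = refl
oddCount-sum {suc n} R with parityBit (R 0F) in eq
... | 0F = trans (cong length (filter-reject odd? {x = R 0F} {xs = toList (R ∘ suc)} (λ odd → odd (parity⇒even eq))))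
                 (oddCount-sum (R ∘ suc))
  where odd? = λ r → ¬? (2 ∣? r)
... | 1F = trans (cong length (filter-accept odd? {x = R 0F} {xs = toList (R ∘ suc)} (parity⇒odd eq)))
                 (cong suc (oddCount-sum (R ∘ suc)))
  where odd? = λ r → ¬? (2 ∣? r)

-- Orbits of indices under reversal.

opposite-fromℕ : ∀ n → opposite (fromℕ n) ≡ 0F
opposite-fromℕ n = opposite-involutive {suc n} 0F

opposite-inject₁ : (i : Fin n) → opposite (inject₁ i) ≡ suc (opposite i)
opposite-inject₁ zero    = refl
opposite-inject₁ (suc i) = cong inject₁ (opposite-inject₁ i)

-- The orbits {i, opposite i}: `nothing` is the fixed point in the middle,
-- reached only for odd n.
orbit : Fin n → Maybe (Fin ⌊ n /2⌋)
orbit {1}           zero    = nothing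
orbit {suc (suc n)} zero    = just zero
orbit {suc (suc n)} (suc i) with view i
... | ‵fromℕ     = just zero
... | ‵inject₁ k = mapMaybe suc (orbit k)

orbit-last : ∀ n → orbit (fromℕ (suc n)) ≡ just zero
orbit-last n rewrite view-fromℕ n = refl

orbit-inner : (k : Fin n) → orbit (suc (inject₁ k)) ≡ mapMaybe suc (orbit k)
orbit-inner k rewrite view-inject₁ k = refl

-- A square of size 2 + n is a frame around one of size n.
frame-elim : (P : Fin (suc (suc n)) → Set) → P zero → P (fromℕ (suc n)) →
             (∀ k → P (suc (inject₁ k))) → ∀ i → P i
frame-elim P first last inner zero    = first
frame-elim P first last inner (suc i) with view i
... | ‵fromℕ     = last
... | ‵inject₁ k = inner k

opposite-inner : (k : Fin n) → opposite (suc (inject₁ k)) ≡ suc (inject₁ (opposite k))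
opposite-inner k = cong inject₁ (opposite-inject₁ k)

orbit-opposite : (i : Fin n) → orbit (opposite i) ≡ orbit i
orbit-opposite {1}           zero = refl
orbit-opposite {suc (suc n)} = frame-elim (λ i → orbit (opposite i) ≡ orbit i)
  (orbit-last n)
  (trans (cong orbit (opposite-fromℕ (suc n))) (sym (orbit-last n)))
  (λ k → trans (cong orbit (opposite-inner k)) (trans (orbit-inner (opposite k))
    (trans (cong (mapMaybe suc) (orbit-opposite k)) (sym (orbit-inner k)))))

orbit-nothing : (i : Fin n) → orbit i ≡ nothing → parityBit n ≡ 1F
orbit-nothing {1}           zero = λ _ → refl
orbit-nothing {suc (suc n)} = frame-elim (λ i → orbit i ≡ nothing → parityBit n ≡ 1F)
  (λ ())
  (λ eq → contradiction (trans (sym (orbit-last n)) eq) λ ())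
  (λ k eq → orbit-nothing k (inner (orbit k) (trans (sym (orbit-inner k)) eq)))
  where
  inner : (x : Maybe (Fin ⌊ n /2⌋)) → mapMaybe Fin.suc x ≡ nothing → x ≡ nothing
  inner nothing  _ = refl

half : Fin ⌊ n /2⌋ → Fin n
half {n} k = inject≤ k (⌊n/2⌋≤n n)

-- For even `n` no index has orbit `nothing`, and `middle n` is then only a default value.
representative : .{{_ : NonZero n}} → Maybe (Fin ⌊ n /2⌋) → Fin n
representative         (just k) = half k
representative {n = n} nothing  = middle n

representative-inner : .{{_ : NonZero n}} (x : Maybe (Fin ⌊ n /2⌋)) →
                       representative {suc (suc n)} (mapMaybe suc x) ≡ suc (inject₁ (representative x))
representative-inner {n} (just k) = cong suc (toℕ-injective
  (trans (toℕ-inject≤ k _) (sym (trans (toℕ-inject₁ _) (toℕ-inject≤ k _)))))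
representative-inner {suc m} nothing = cong suc (toℕ-injective
  (trans (toℕ-fromℕ< _) (sym (trans (toℕ-inject₁ _) (toℕ-fromℕ< _)))))

Represents : .{{_ : NonZero n}} → Fin n → Set
Represents i = representative (orbit i) ≡ i ⊎ representative (orbit i) ≡ opposite i

represents-inner : .{{_ : NonZero n}} (k : Fin n) → Represents k → Represents (suc (inject₁ k))
represents-inner k = λ
  { (inj₁ eq) → inj₁ (trans step (cong (suc ∘ inject₁) eq))
  ; (inj₂ eq) → inj₂ (trans step (trans (cong (suc ∘ inject₁) eq) (sym (opposite-inner k)))) }
  where
  step : representative (orbit (suc (inject₁ k))) ≡ suc (inject₁ (representative (orbit k)))
  step = trans (cong representative (orbit-inner k)) (representative-inner (orbit k))

-- The recursion strips two indices at a time and must stop at a nonzero size for `middle` to make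
-- sense, hence the base cases 1 and 2.
representative-orbit : .{{_ : NonZero n}} (i : Fin n) → Represents i
representative-orbit {1}                   zero       = inj₁ refl
representative-orbit {2}                   zero       = inj₁ refl
representative-orbit {2}                   (suc zero) = inj₂ refl
representative-orbit {suc (suc n@(suc _))} = frame-elim Represents
  (inj₁ refl)
  (inj₂ (trans (cong representative (orbit-last n)) (sym (opposite-fromℕ (suc n)))))
  (λ k → represents-inner k (representative-orbit k))

-- Every `just k` is the orbit of two indices, `nothing` that of one index for odd `n` and of none
-- for even `n`.
sum-orbit : (g : Maybe (Fin ⌊ n /2⌋) → ℕ) →
            sum {n} (g ∘ orbit) ≡ sum (g ∘ just) + sum (g ∘ just) + toℕ (parityBit n) * g nothing
sum-orbit {0}           g = refl
sum-orbit {1}           g = refl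
sum-orbit {suc (suc n)} g = begin
  g (just 0F) + sum (g ∘ orbit ∘ suc)
    ≡⟨ cong (g (just 0F) +_) (sum-init-last (g ∘ orbit ∘ suc)) ⟩
  g (just 0F) + (sum (g ∘ orbit ∘ suc ∘ inject₁) + g (orbit (fromℕ (suc n))))
    ≡⟨ cong (g (just 0F) +_) (cong₂ _+_
         (trans (sum-cong-≗ {n} (cong g ∘ orbit-inner)) (sum-orbit (g ∘ mapMaybe suc)))
         (cong g (orbit-last n))) ⟩
  g (just 0F) + (∑½ + ∑½ + toℕ (parityBit n) * g nothing + g (just 0F))
    ≡⟨ lemma (g (just 0F)) ∑½ (toℕ (parityBit n) * g nothing) ⟩
  g (just 0F) + ∑½ + (g (just 0F) + ∑½) + toℕ (parityBit n) * g nothing ∎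
  where
  open ≡-Reasoning
  ∑½ : ℕ
  ∑½ = sum (g ∘ just ∘ suc)
  lemma : ∀ a b c → a + (b + b + c + a) ≡ a + b + (a + b) + c
  lemma = solve-∀

palindromic-orbit : {A : Set} .{{_ : NonZero n}} (g : Fin n → A) → (∀ i → g i ≡ g (opposite i)) →
                    ∀ i → g i ≡ g (representative (orbit i))
palindromic-orbit g pal i with representative-orbit i
... | inj₁ eq = cong g (sym eq)
... | inj₂ eq = trans (pal i) (cong g (sym eq))

sum-palindromic : .{{_ : NonZero n}} (g : Vector ℕ n) → Palindromic g →
                  sum g ≡ sum (g ∘ half) + sum (g ∘ half) + toℕ (parityBit n) * g (middle n)
sum-palindromic {n} g pal = trans (sum-cong-≗ (palindromic-orbit g pal)) (sum-orbit (g ∘ representative))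

-- Dihedral symmetry and the two directions of the criterion.

toℕ-∧ : ∀ x y → toℕ (x ∧ y) ≡ toℕ x * toℕ y
toℕ-∧ 0F y = refl
toℕ-∧ 1F y = sym (+-identityʳ (toℕ y))

-- Serves composites: `h A` equals `A` only entrywise, and an arbitrary map of matrices need not
-- respect `≈`.
D₄-cong : {A B : Matrix n} → ∀ {g} → D₄ g → A ≈ B → g A ≈ g B
D₄-cong ι∈       A≈B i j = A≈B i j
D₄-cong τ∈       A≈B i j = A≈B j i
D₄-cong ρ∈       A≈B i j = A≈B i (opposite j)
D₄-cong (∘∈ g h) A≈B     = D₄-cong g (D₄-cong h A≈B)

fixed-by-D₄ : {A : Matrix n} → transpose A ≈ A → reflect A ≈ A → ∀ {g} → D₄ g → g A ≈ A
fixed-by-D₄ Aᵗ≈A rA≈A ι∈       i j = refl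
fixed-by-D₄ Aᵗ≈A rA≈A τ∈       i j = Aᵗ≈A i j
fixed-by-D₄ Aᵗ≈A rA≈A ρ∈       i j = rA≈A i j
fixed-by-D₄ Aᵗ≈A rA≈A (∘∈ g h) i j =
  trans (D₄-cong g (fixed-by-D₄ Aᵗ≈A rA≈A h) i j) (fixed-by-D₄ Aᵗ≈A rA≈A g i j)

Criterion : (n : ℕ) .{{_ : NonZero n}} (R S : Vector ℕ n) → Set
Criterion n R S =
  R ≗ S
  × Palindromic R
  × ((Even n → ∀ i → Even (R i)) × (Odd n → oddCount R ≡ R (middle n)))
  × toList (halved R) ⪯ conjugate (toList (halved R))

necessary : .{{_ : NonZero n}} (R S : Vector ℕ n) → ∃ (𝒜⁴ R S) → Criterion n R S
necessary {n} R S (A , A∈) = R≗S , palindromic , (evenRows , oddRows) ,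
  ryser⇒⪯conjugate (halved R) (realisable⇒Ryser quarter)
  where
  open 𝒜⁴ A∈

  A-sym : ∀ i j → A i j ≡ A j i
  A-sym i j = fixed τ∈ j i

  R≗S : R ≗ S
  R≗S i = trans (sym (rowSums i)) (trans (sum-cong-≗ λ j → cong toℕ (A-sym i j)) (colSums i))

  -- Reversing the rows is the reversal of columns conjugated by transposition.
  A-opposite : ∀ i j → A i j ≡ A (opposite i) j
  A-opposite i j = trans (A-sym i j) (trans (sym (fixed ρ∈ j i)) (A-sym j (opposite i)))

  palindromic : Palindromic R
  palindromic i = trans (sym (rowSums i))
    (trans (sum-cong-≗ λ j → cong toℕ (A-opposite i j)) (rowSums (opposite i)))

  half-row : Fin n → ℕ
  half-row i = sum (λ k → toℕ (A i (half k)))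

  -- Row `i` is a palindrome, so its halves agree and a middle entry is left over for odd `n`.
  -- Writing the remainder as a bit lets parity and half of `R i` be read off.
  split : ∀ i → R i ≡ half-row i + half-row i + toℕ (parityBit n ∧ A i (middle n))
  split i = trans (sym (rowSums i)) (trans
    (sum-palindromic (toℕ ∘ A i) λ j → cong toℕ (sym (fixed ρ∈ i j)))
    (cong (half-row i + half-row i +_) (sym (toℕ-∧ (parityBit n) _))))

  parity-row : ∀ i → parityBit (R i) ≡ parityBit n ∧ A i (middle n)
  parity-row i = trans (cong parityBit (split i)) (parity-double (half-row i) _)

  evenRows : Even n → ∀ i → Even (R i)
  evenRows even i = parity⇒even (trans (parity-row i) (cong (_∧ A i (middle n)) (even⇒parity even)))

  oddRows : Odd n → oddCount R ≡ R (middle n)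
  -- The odd rows are those with a one in the middle column, which by symmetry is the middle row.
  oddRows odd = begin
    oddCount R                         ≡⟨ oddCount-sum R ⟩
    sum (λ i → toℕ (parityBit (R i)))  ≡⟨ sum-cong-≗ (λ i → cong toℕ (trans (parity-row i)
                                            (trans (cong (_∧ A i (middle n)) (odd⇒parity odd)) (A-sym i _)))) ⟩
    sum (λ i → toℕ (A (middle n) i))   ≡⟨ rowSums (middle n) ⟩
    R (middle n)                       ∎
    where open ≡-Reasoning

  quarter : Realisable (halved R)
  quarter = realisation (λ k l → A (half k) (half l)) (λ k l → A-sym _ _) λ k →
    trans (sym (half-double (half-row (half k)) (parityBit n ∧ A (half k) (middle n))))
      (cong ⌊_/2⌋ (sym (split (half k))))

sufficient : .{{_ : NonZero n}} (R S : Vector ℕ n) → Criterion n R S → ∃ (𝒜⁴ R S)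
sufficient {n} R S (R≗S , palindromic , (evenRows , oddRows) , dominated) = A , record
  { rowSums = A-row
  ; colSums = λ j → trans (sum-cong-≗ λ i → cong toℕ (A-sym i j)) (trans (A-row j) (R≗S j))
  ; fixed   = fixed-by-D₄ (λ i j → A-sym j i) (λ i j → cong (M (orbit i)) (orbit-opposite j))
  }
  where
  open Realisable (realise (halved R) (⪯conjugate⇒ryser (halved R) dominated))
    renaming (matrix to B; symmetric to B-sym; rowSum to B-row)

  -- The entries in the middle row and column are forced by the parities of R.
  M : Maybe (Fin ⌊ n /2⌋) → Maybe (Fin ⌊ n /2⌋) → Fin 2
  M (just k) (just l) = B k l
  M (just k) nothing  = parityBit (R (half k))
  M nothing  y        = parityBit (R (representative y))

  M-sym : ∀ x y → M x y ≡ M y x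
  M-sym (just k) (just l) = B-sym k l
  M-sym (just k) nothing  = refl
  M-sym nothing  (just l) = refl
  M-sym nothing  nothing  = refl

  -- Entries depend only on the orbits of their indices, which makes `A` invariant under `reflect`.
  A : Matrix n
  A i j = M (orbit i) (orbit j)

  A-sym : ∀ i j → A i j ≡ A j i
  A-sym i j = M-sym (orbit i) (orbit j)

  -- For even `n` there is no middle column to absorb a parity, but then every row sum is even.
  parity-∧ : ∀ i → parityBit n ∧ parityBit (R i) ≡ parityBit (R i)
  parity-∧ i with parityBit n in eq
  ... | 1F = refl
  ... | 0F = sym (even⇒parity (evenRows (parity⇒even eq) i))

  -- A middle row occurs only for odd `n`. Its entries are the parities of `R`, so its sum is
  -- `oddCount R`, and the hypothesis on `nothing` gives access to `oddRows`.
  M-row : ∀ x → (x ≡ nothing → Odd n) → sum {n} (λ j → toℕ (M x (orbit j))) ≡ R (representative x)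
  M-row (just k) _ = begin
    sum {n} (λ j → toℕ (M (just k) (orbit j)))
      ≡⟨ sum-orbit (toℕ ∘ M (just k)) ⟩
    sum (toℕ ∘ B k) + sum (toℕ ∘ B k) + toℕ (parityBit n) * toℕ (parityBit (R (half k)))
      ≡⟨ cong₂ _+_ (cong₂ _+_ (B-row k) (B-row k))
           (trans (sym (toℕ-∧ (parityBit n) _)) (cong toℕ (parity-∧ (half k)))) ⟩
    halved R k + halved R k + toℕ (parityBit (R (half k)))
      ≡⟨ halves+parity (R (half k)) ⟩
    R (half k) ∎
    where open ≡-Reasoning
  M-row nothing odd = begin
    sum (λ j → toℕ (parityBit (R (representative (orbit j)))))
      ≡⟨ sum-cong-≗ (λ j → cong (toℕ ∘ parityBit) (palindromic-orbit R palindromic j)) ⟨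
    ∣ parityBit ∘ R ∣
      ≡⟨ oddCount-sum R ⟨
    oddCount R
      ≡⟨ oddRows (odd refl) ⟩
    R (middle n) ∎
    where open ≡-Reasoning

  A-row : ∀ i → sum (λ j → toℕ (A i j)) ≡ R i
  A-row i = trans (M-row (orbit i) (λ eq → parity⇒odd (orbit-nothing i eq)))
    (sym (palindromic-orbit R palindromic i))

theorem19 : (n : ℕ) .{{_ : NonZero n}} (R S : Vector ℕ n) →
    (∀ i → R i ≤ n) → (∀ j → S j ≤ n) → sum R ≡ sum S →
    ∃ (𝒜⁴ R S) ⇔
    ( R ≗ S
    × Palindromic R
    × ((Even n → ∀ i → Even (R i)) × (Odd n → oddCount R ≡ R (middle n)))
    × toList (halved R) ⪯ conjugate (toList (halved R)) )
theorem19 n R S _ _ _ = mk⇔ (necessary R S) (sufficient R S)
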